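{- Let $G$ be a connected $\{\text{butterfly},\text{hammer}\}$-free graph with $\omega(G)\neq 2$. Then: (i) There exists a partition $V(G)=X_1\cup X_2\cup X_3\cup X_4\cup X_5$ (into pairwise disjoint sets, some possibly empty) such that $X_1$ is a dominating set of $G$, $\langle X_1\rangle$ is an $\omega(G)$-partite graph with $\omega(\langle X_1\rangle)=\omega(G)$, each of $X_2$, $X_3$, $X_4$ is an independent set, and $\langle X_1\cup X_5\rangle$ is $2K_2$-free. (ii) $\chi(G)\leq \binom{\omega(G)+1}{2}$.
   Context: All graphs are simple, finite and undirected. $\omega(G)$ is the clique number and $\chi(G)$ the chromatic number of $G$. For $S\subseteq V(G)$, $\langle S\rangle$ denotes the subgraph induced by $S$. For a family $\mathcal{F}$ of graphs, $G$ is $\mathcal{F}$-free if it has no induced subgraph isomorphic to a member of $\mathcal{F}$. The butterfly is the graph on five vertices consisting of two triangles sharing exactly one vertex (with no other edges). The hammer is the graph on five vertices $a,b,c,d,e$ with edges $ab,bc,ac,cd,de$. $2K_2$ is the disjoint union of two copies of $K_2$. A set $S\subseteq V(G)$ is dominating if every vertex of $V(G)\setminus S$ has a neighbor in $S$. A graph is $k$-partite if its vertex set can be partitioned into $k$ independent sets. -}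

module Defs where

open import Data.Bool.Base using (true; false; if_then_else_)
open import Data.Empty using (⊥-elim)
open import Data.Fin.Base using (Fin; zero; suc; finToFun; funToFin)
open import Data.Fin.Patterns using (0F; 1F; 2F; 3F; 4F)
open import Data.Fin.Properties using (_≟_; all?; any?; suc-injective; finToFun-funToFin)
open import Data.Fin.Subset using (Subset; _∈_; _∉_; _∩_; Empty; ∣_∣; ⊥)
open import Data.Fin.Subset.Properties using (_∈?_; anySubset?; ∣p∣≤n; ∉⊥; ∣⊥∣≡0)
open import Data.List.Base using (List; []; _∷_)
import Data.List.Membership.DecPropositional as DecMembership
open import Data.List.Relation.Unary.All using (All)
open import Data.Nat.Base using (ℕ; zero; suc; _≤_; z≤n; s≤s)
import Data.Nat.Properties as ℕ
open import Data.Product.Base using (∃; Σ-syntax; _×_; _,_; map₂)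
open import Data.Product.Properties using (≡-dec)
open import Data.Sum.Base using (_⊎_)
import Data.Sum.Base as Sum
open import Data.Vec.Base using (Vec; []; _∷_; lookup; here; there)
open import Function.Base using (_∘_; id)
open import Function.Bundles using (_↔_; _⇔_; Inverse)
open import Level using (0ℓ)
open import Relation.Binary.Core using (Rel)
open import Relation.Binary.Construct.Closure.ReflexiveTransitive using (Star)
open import Relation.Binary.Definitions using (Decidable; Symmetric; Irreflexive)
open import Relation.Binary.PropositionalEquality
  using (_≡_; _≢_; refl; ≢-sym; cong; subst₂)
open import Relation.Nullary.Decidable.Core
  using (Dec; yes; no; ¬?; map′; _×-dec_; _⊎-dec_; _→-dec_)
open import Relation.Nullary.Negation.Core using (¬_)

record Graph (n : ℕ) : Set₁ where
  field
    _~_    : Rel (Fin n) 0ℓ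
    ~-sym  : Symmetric _~_
    ~-irr  : Irreflexive _≡_ _~_
    _~?_   : Decidable _~_

record _≅_ {m n : ℕ} (G : Graph m) (H : Graph n) : Set where
  private
    module G = Graph G
    module H = Graph H
  field
    vertices : Fin m ↔ Fin n
    adjacent : ∀ u v → (u G.~ v) ⇔ (Inverse.to vertices u H.~ Inverse.to vertices v)

infix 4 _≅_

-- The elements of S listed in increasing order; this is how the vertices of
-- an induced subgraph are renumbered as Fin ∣ S ∣.
element : ∀ {n} (S : Subset n) → Fin ∣ S ∣ → Fin n
element (true  ∷ S) zero    = zero
element (true  ∷ S) (suc i) = suc (element S i)
element (false ∷ S) i       = suc (element S i)

element-injective : ∀ {n} (S : Subset n) {i j} → element S i ≡ element S j → i ≡ j
element-injective (true  ∷ S) {zero}  {zero}  eq = refl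
element-injective (true  ∷ S) {suc i} {suc j} eq =
  cong suc (element-injective S (suc-injective eq))
element-injective (false ∷ S) eq = element-injective S (suc-injective eq)

element-∈ : ∀ {n} (S : Subset n) i → element S i ∈ S
element-∈ (true  ∷ S) zero    = here
element-∈ (true  ∷ S) (suc i) = there (element-∈ S i)
element-∈ (false ∷ S) i       = there (element-∈ S i)

element-surjective : ∀ {n} (S : Subset n) {v} → v ∈ S → ∃ λ i → element S i ≡ v
element-surjective (true  ∷ S) here = zero , refl
element-surjective (true  ∷ S) (there v∈S) with element-surjective S v∈S
... | i , eq = suc i , cong suc eq
element-surjective (false ∷ S) (there v∈S) = map₂ (cong suc) (element-surjective S v∈S)

⟨_⟩[_] : ∀ {n} → Graph n → (S : Subset n) → Graph ∣ S ∣
⟨ G ⟩[ S ] = record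
  { _~_   = λ i j → element S i ~ element S j
  ; ~-sym = ~-sym
  ; ~-irr = λ i≡j → ~-irr (cong (element S) i≡j)
  ; _~?_  = λ i j → element S i ~? element S j
  }
  where open Graph G

infix 4 _-Free_

_-Free_ : ∀ {n} → List (∃ Graph) → Graph n → Set₁
_-Free_ {n} 𝓕 G = All (λ (_ , H) → ¬ (Σ[ S ∈ Subset n ] ⟨ G ⟩[ S ] ≅ H)) 𝓕

-- Each edge is listed in one orientation only; loops in the list are ignored.
fromEdges : ∀ {n} → List (Fin n × Fin n) → Graph n
fromEdges {n} es = record
  { _~_   = λ u v → u ≢ v × ((u , v) M.∈ es ⊎ (v , u) M.∈ es)
  ; ~-sym = λ (u≢v , e) → ≢-sym u≢v , Sum.swap e
  ; ~-irr = λ u≡v (u≢v , _) → u≢v u≡v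
  ; _~?_  = λ u v → ¬? (u ≟ v) ×-dec ((u , v) M.∈? es ⊎-dec (v , u) M.∈? es)
  }
  where module M = DecMembership (≡-dec (_≟_ {n}) (_≟_ {n}))

butterfly : Graph 5
butterfly = fromEdges
  ( (0F , 1F) ∷ (0F , 2F) ∷ (1F , 2F)
  ∷ (0F , 3F) ∷ (0F , 4F) ∷ (3F , 4F) ∷ [] )

hammer : Graph 5
hammer = fromEdges
  ((0F , 1F) ∷ (1F , 2F) ∷ (0F , 2F) ∷ (2F , 3F) ∷ (3F , 4F) ∷ [])

2K₂ : Graph 4
2K₂ = fromEdges ((0F , 1F) ∷ (2F , 3F) ∷ [])

IsPartition : ∀ {n k} → Vec (Subset n) k → Set
IsPartition Xs =
  (∀ v → ∃ λ i → v ∈ lookup Xs i) ×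
  (∀ i j → i ≢ j → Empty (lookup Xs i ∩ lookup Xs j))

module _ {n : ℕ} (G : Graph n) where
  open Graph G

  Connected : Set
  Connected = ∀ u v → Star _~_ u v

  Independent : Subset n → Set
  Independent S = ∀ u v → u ∈ S → v ∈ S → ¬ (u ~ v)

  Dominating : Subset n → Set
  Dominating S = ∀ v → v ∉ S → ∃ λ u → u ∈ S × v ~ u

  Partite : ℕ → Set
  Partite k = Σ[ Xs ∈ Vec (Subset n) k ]
    IsPartition Xs × (∀ i → Independent (lookup Xs i))

  Clique : Subset n → Set
  Clique S = ∀ u v → u ∈ S → v ∈ S → u ≢ v → u ~ v

  HasClique : ℕ → Set
  HasClique k = Σ[ S ∈ Subset n ] Clique S × ∣ S ∣ ≡ k

  Colourable : ℕ → Set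
  Colourable k = Σ[ c ∈ (Fin n → Fin k) ] (∀ u v → u ~ v → c u ≢ c v)

  clique? : ∀ S → Dec (Clique S)
  clique? S = all? λ u → all? λ v →
    (u ∈? S) →-dec ((v ∈? S) →-dec (¬? (u ≟ v) →-dec (u ~? v)))

  hasClique? : ∀ k → Dec (HasClique k)
  hasClique? k = anySubset? λ S → clique? S ×-dec (∣ S ∣ ℕ.≟ k)

  colourable? : ∀ k → Dec (Colourable k)
  colourable? k = map′
    (λ (i , p) → finToFun i , p)
    (λ (c , p) → funToFin c , λ u v u~v eq → p u v u~v
      (subst₂ _≡_ (finToFun-funToFin c u) (finToFun-funToFin c v) eq))
    (any? λ i → all? λ u → all? λ v →
      (u ~? v) →-dec ¬? (finToFun i u ≟ finToFun i v))

-- greatest P? b is the largest k ≤ b satisfying P, and 0 if there is none;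
-- least P? b is the smallest k < b satisfying P, and b if there is none.
greatest least : {P : ℕ → Set} → (∀ k → Dec (P k)) → ℕ → ℕ

greatest P? zero    = zero
greatest P? (suc b) = if Dec.does (P? (suc b)) then suc b else greatest P? b

least P? zero    = zero
least P? (suc b) = if Dec.does (P? zero) then zero else suc (least (P? ∘ suc) b)

-- The bounds n are harmless: no clique has more than n vertices, and n colours
-- always suffice (see the lemmas below).
ω : ∀ {n} → Graph n → ℕ
ω {n} G = greatest (hasClique? G) n

χ : ∀ {n} → Graph n → ℕ
χ {n} G = least (colourable? G) n

greatest-upper : ∀ {P : ℕ → Set} (P? : ∀ k → Dec (P k)) b {k} → k ≤ b → P k → k ≤ greatest P? b
greatest-upper P? zero    k≤b p = k≤b
greatest-upper P? (suc b) {k} k≤b p with P? (suc b)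
... | yes _ = k≤b
... | no ¬p = greatest-upper P? b
  (ℕ.≤-pred (ℕ.≤∧≢⇒< k≤b λ { refl → ¬p p })) p

greatest-holds : ∀ {P : ℕ → Set} (P? : ∀ k → Dec (P k)) b → P 0 → P (greatest P? b)
greatest-holds P? zero    p₀ = p₀
greatest-holds P? (suc b) p₀ with P? (suc b)
... | yes p = p
... | no  _ = greatest-holds P? b p₀

least-lower : ∀ {P : ℕ → Set} (P? : ∀ k → Dec (P k)) b {k} → P k → least P? b ≤ k
least-lower P? zero    p = z≤n
least-lower P? (suc b) {k} p with P? zero
least-lower P? (suc b) {k}     p | yes _ = z≤n
least-lower P? (suc b) {zero}  p | no ¬p = ⊥-elim (¬p p)
least-lower P? (suc b) {suc k} p | no _  = s≤s (least-lower (P? ∘ suc) b p)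

least-holds : ∀ {P : ℕ → Set} (P? : ∀ k → Dec (P k)) b → P b → P (least P? b)
least-holds P? zero    p = p
least-holds P? (suc b) p with P? zero
... | yes p₀ = p₀
... | no  _  = least-holds (P? ∘ suc) b p

module _ {n : ℕ} (G : Graph n) where
  open Graph G

  ω-attained : HasClique G (ω G)
  ω-attained = greatest-holds (hasClique? G) n (⊥ , empty , ∣⊥∣≡0 n)
    where
    empty : Clique G ⊥
    empty u v u∈⊥ = ⊥-elim (∉⊥ u∈⊥)

  ω-upper : ∀ S → Clique G S → ∣ S ∣ ≤ ω G
  ω-upper S cl = greatest-upper (hasClique? G) n (∣p∣≤n S) (S , cl , refl)

  χ-attained : Colourable G (χ G)
  χ-attained = least-holds (colourable? G) n (id , λ u v u~v u≡v → ~-irr u≡v u~v)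

  χ-lower : ∀ {k} → Colourable G k → χ G ≤ k
  χ-lower = least-lower (colourable? G) n

-- Fix a maximum clique x₀, …, x_{ω-1} and record, for each vertex v, the set of
-- indices that v misses, i.e. the i with v ≁ xᵢ (so xᵢ misses exactly i).  By
-- maximality every vertex misses some index, and two adjacent vertices cannot
-- both miss exactly {i}.  Excluding the butterfly and the hammer means exactly
-- that no vertex is adjacent to three vertices of an induced 2K₂.  When ω ≥ 3
-- this and connectedness imply that two adjacent vertices cannot both miss two
-- given indices.  Hence colouring v by {i , j}, two indices that it misses, or by
-- {i , i} if it misses i only, is proper.
--
-- For the partition, X₁ consists of the vertices that miss exactly one index,
-- and X₂, X₃, X₄ of the other vertices that miss two of the indices 0, 1, 2.
-- The vertices of an induced 2K₂ in X₁ ∪ X₅ miss together at most four of the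
-- indices 0, 1, 2, so one of x₀, x₁, x₂ is adjacent to at least three of them.
module Submission where

open import Defs
open import Data.Bool.Base using (Bool; true; false; if_then_else_)
import Data.Empty as Empty
open import Data.Fin.Base using (Fin; zero; suc; toℕ; fromℕ<; _<_; _↑ˡ_)
open import Data.Fin.Patterns using (0F; 1F; 2F; 3F; 4F)
open import Data.Fin.Properties
  using (_≟_; _<?_; all?; any?; <-cmp; toℕ-injective; toℕ<n; fromℕ<-injective;
         injective⇒≤; ↑ˡ-injective; ¬∀⟶∃¬)
open import Data.Fin.Subset using (Subset; _∈_; _∪_; ∣_∣)
open import Data.Fin.Subset.Properties using (x∈p∩q⁻; x∈p∪q⁻)
open import Data.List.Base using (_∷_; []; allFin; tabulate)
open import Data.List.Relation.Unary.All using (_∷_; [])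
open import Data.List.Relation.Unary.All.Properties using (tabulate⁻)
open import Data.List.Relation.Unary.AllPairs using (AllPairs; _∷_; [])
open import Data.Nat.Base using (ℕ; zero; suc; _+_; _≤_; z≤n; s≤s; s≤s⁻¹; ≤′-refl; ≤′-step)
import Data.Nat.Base as ℕ
open import Data.Nat.Combinatorics using (_C_; nC1≡n; nCk+nC[k+1]≡[n+1]C[k+1])
import Data.Nat.Properties as ℕ
open import Data.Product.Base using (_×_; _,_; Σ-syntax; ∃; ∃₂; proj₁; proj₂)
open import Data.Sum.Base using (_⊎_; inj₁; inj₂)
open import Data.Vec.Base using (Vec; _∷_; []; lookup)
import Data.Vec.Base as Vec
open import Data.Vec.Functional using () renaming (_∷_ to _◂_)
open import Data.Vec.Properties using (lookup∘tabulate; lookup⇒[]=; []=⇒lookup)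
open import Function.Base using (_∘_; const)
open import Function.Bundles using (_⇔_; Inverse; mk⇔; mk↔ₛ′; module Equivalence)
open import Function.Definitions using (Injective)
open import Level using (0ℓ)
open import Relation.Binary.Construct.Closure.ReflexiveTransitive using (Star; ε; _◅_)
open import Relation.Binary.Definitions using (tri<; tri≈; tri>)
open import Relation.Binary.PropositionalEquality
  using (_≡_; _≢_; refl; sym; trans; cong; subst; subst₂; ≢-sym)
open import Relation.Nullary.Decidable
  using (Dec; yes; no; does; ¬?; _×-dec_; _⊎-dec_; _→-dec_; decidable-stable; from-yes; from-no; dec-true)
open import Relation.Nullary.Negation.Core using (¬_; contradiction)
open import Relation.Unary using (Pred; Decidable)

-- Subsets

select : ∀ {n} {P : Pred (Fin n) 0ℓ} → Decidable P → Subset n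
select P? = Vec.tabulate (does ∘ P?)

∈-select⁺ : ∀ {n} {P : Pred (Fin n) 0ℓ} (P? : Decidable P) {v} → P v → v ∈ select P?
∈-select⁺ P? {v} p =
  lookup⇒[]= v (select P?) (trans (lookup∘tabulate (does ∘ P?) v) (dec-true (P? v) p))

∈-select⁻ : ∀ {n} {P : Pred (Fin n) 0ℓ} (P? : Decidable P) {v} → v ∈ select P? → P v
∈-select⁻ P? {v} v∈
  with P? v | trans (sym (lookup∘tabulate (does ∘ P?) v)) ([]=⇒lookup v∈)
... | yes p | _ = p

fibre : ∀ {n k} → (Fin n → Fin k) → Fin k → Subset n
fibre c i = select (λ v → c v ≟ i)

fibres : ∀ {n k} → (Fin n → Fin k) → Vec (Subset n) k
fibres c = Vec.tabulate (fibre c)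

∈-fibre⁺ : ∀ {n k} (c : Fin n → Fin k) {i v} → c v ≡ i → v ∈ fibre c i
∈-fibre⁺ c {i} = ∈-select⁺ (λ v → c v ≟ i)

∈-fibre⁻ : ∀ {n k} (c : Fin n → Fin k) {i v} → v ∈ fibre c i → c v ≡ i
∈-fibre⁻ c {i} = ∈-select⁻ (λ v → c v ≟ i)

∈-fibres⁻ : ∀ {n k} (c : Fin n → Fin k) i {v} → v ∈ lookup (fibres c) i → c v ≡ i
∈-fibres⁻ c i {v} v∈ = ∈-fibre⁻ c (subst (v ∈_) (lookup∘tabulate (fibre c) i) v∈)

fibres-partition : ∀ {n k} (c : Fin n → Fin k) → IsPartition (fibres c)
fibres-partition c =
  (λ v → c v , subst (v ∈_) (sym (lookup∘tabulate (fibre c) (c v))) (∈-fibre⁺ c refl)) ,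
  (λ i j i≢j (v , v∈) →
    let v∈i , v∈j = x∈p∩q⁻ (lookup (fibres c) i) (lookup (fibres c) j) v∈ in
    i≢j (trans (sym (∈-fibres⁻ c i v∈i)) (∈-fibres⁻ c j v∈j)))

-- `index` and `preindex` translate between the numbering by `f` and that by `element image`; for
-- injective `f` they are mutually inverse.
module Image {m n} (f : Fin m → Fin n) where
  private
    hit? : ∀ v → Dec (∃ λ i → f i ≡ v)
    hit? v = any? (λ i → f i ≟ v)

  image : Subset n
  image = select hit?

  ∈-image⁻ : ∀ {v} → v ∈ image → ∃ λ i → f i ≡ v
  ∈-image⁻ = ∈-select⁻ hit?

  index : Fin m → Fin ∣ image ∣
  index i = proj₁ (element-surjective image (∈-select⁺ hit? (i , refl)))

  element-index : ∀ i → element image (index i) ≡ f i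
  element-index i = proj₂ (element-surjective image (∈-select⁺ hit? (i , refl)))

  preindex : Fin ∣ image ∣ → Fin m
  preindex u = proj₁ (∈-image⁻ (element-∈ image u))

  preindex-element : ∀ u → f (preindex u) ≡ element image u
  preindex-element u = proj₂ (∈-image⁻ (element-∈ image u))

  index-injective : Injective _≡_ _≡_ f → Injective _≡_ _≡_ index
  index-injective inj {i} {j} eq = inj (trans (sym (element-index i))
    (trans (cong (element image) eq) (element-index j)))

-- Induced copies

record Copy {m n} (H : Graph m) (G : Graph n) (f : Fin m → Fin n) : Set where
  private
    module H = Graph H
    module G = Graph G
  field
    injective : Injective _≡_ _≡_ f
    adjacent  : ∀ i j → (f i G.~ f j) ⇔ (i H.~ j)

copy⇒induced : ∀ {m n} (H : Graph m) (G : Graph n) {f} → Copy H G f →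
  Σ[ S ∈ Subset n ] ⟨ G ⟩[ S ] ≅ H
copy⇒induced H G {f} copy = image , record
  { vertices = mk↔ₛ′ preindex index
      (λ i → injective (trans (preindex-element (index i)) (element-index i)))
      (λ u → element-injective image (trans (element-index (preindex u)) (preindex-element u)))
  ; adjacent = λ u v → mk⇔
      (λ e → to (adjacent _ _) (subst₂ G._~_ (sym (preindex-element u)) (sym (preindex-element v)) e))
      (λ e → subst₂ G._~_ (preindex-element u) (preindex-element v) (from (adjacent _ _) e))
  }
  where
  module G = Graph G
  open Copy copy
  open Equivalence
  open Image f

≅⇒adjacent : ∀ {m n} {G : Graph m} {H : Graph n} (iso : G ≅ H) → let open Inverse (_≅_.vertices iso) in
  ∀ i j → Graph._~_ G (from i) (from j) ⇔ Graph._~_ H i j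
≅⇒adjacent {G = G} {H} iso i j =
  subst₂ (λ i′ j′ → Graph._~_ G (from i) (from j) ⇔ Graph._~_ H i′ j′)
    (strictlyInverseˡ i) (strictlyInverseˡ j) (_≅_.adjacent iso (from i) (from j))
  where open Inverse (_≅_.vertices iso)

-- Non-adjacency does not separate two vertices, so `false` also asks for `u ≢ v`; for `true`,
-- irreflexivity supplies it.
Agrees : ∀ {n} → Graph n → Fin n → Fin n → Bool → Set
Agrees G u v true  = Graph._~_ G u v
Agrees G u v false = u ≢ v × ¬ Graph._~_ G u v

lookup-pair : ∀ {A : Set} {R : A → A → Set} {n} {f : Fin n → A} →
  AllPairs R (tabulate f) → ∀ {i j} → i < j → R (f i) (f j)
lookup-pair (r ∷ _)  {zero}  {suc j} _   = tabulate⁻ r j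
lookup-pair (_ ∷ rs) {suc i} {suc j} i<j = lookup-pair rs (s≤s⁻¹ i<j)

-- For a concrete `H` the hypothesis evaluates to the upper triangle of its adjacency matrix, row by
-- row; symmetry gives the lower triangle.
agrees⇒copy : ∀ {m n} (H : Graph m) (G : Graph n) (f : Fin m → Fin n) →
  AllPairs (λ i j → Agrees G (f i) (f j) (does (Graph._~?_ H i j))) (allFin m) → Copy H G f
agrees⇒copy H G f ps = record { injective = injective ; adjacent = adjacent }
  where
  module G = Graph G
  module H = Graph H

  below : ∀ {i j} → i < j → f i ≢ f j × ((f i G.~ f j) ⇔ (i H.~ j))
  below {i} {j} i<j with i H.~? j | lookup-pair ps i<j
  ... | yes h | g         = (λ eq → G.~-irr eq g) , mk⇔ (const h) (const g)
  ... | no ¬h | f≢ , ¬g   = f≢ , mk⇔ (λ g → contradiction g ¬g) (λ h → contradiction h ¬h)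

  injective : Injective _≡_ _≡_ f
  injective {i} {j} eq with <-cmp i j
  ... | tri< i<j _ _ = contradiction eq (proj₁ (below i<j))
  ... | tri≈ _ i≡j _ = i≡j
  ... | tri> _ _ j<i = contradiction (sym eq) (proj₁ (below j<i))

  adjacent : ∀ i j → (f i G.~ f j) ⇔ (i H.~ j)
  adjacent i j with <-cmp i j
  ... | tri< i<j _ _  = proj₂ (below i<j)
  ... | tri≈ _ refl _ = mk⇔ (λ e → contradiction e (G.~-irr refl)) (λ e → contradiction e (H.~-irr refl))
  ... | tri> _ _ j<i  = let e = proj₂ (below j<i) in
    mk⇔ (H.~-sym ∘ Equivalence.to e ∘ G.~-sym) (G.~-sym ∘ Equivalence.from e ∘ H.~-sym)

-- Cliques and colourings

module _ {n} (G : Graph n) where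
  open Graph G

  -- Cliques are indexed families, so that adding or exchanging a vertex requires no counting;
  -- irreflexivity makes them injective.
  CliqueFamily : ∀ {m} → (Fin m → Fin n) → Set
  CliqueFamily f = ∀ i j → i ≢ j → f i ~ f j

  CliqueBound : ℕ → Set
  CliqueBound w = ∀ {m} (f : Fin m → Fin n) → CliqueFamily f → m ≤ w

  hasClique⇒family : ∀ {w} → HasClique G w → ∃ λ (x : Fin w → Fin n) → CliqueFamily x
  hasClique⇒family (S , clique , refl) = element S , λ i j i≢j →
    clique _ _ (element-∈ S i) (element-∈ S j) (i≢j ∘ element-injective S)

  ω-bound : CliqueBound (ω G)
  ω-bound {m} f family = ℕ.≤-trans (injective⇒≤ (index-injective injective)) (ω-upper G image clique)
    where
    open Image f

    injective : Injective _≡_ _≡_ f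
    injective {i} {j} eq with i ≟ j
    ... | yes i≡j = i≡j
    ... | no  i≢j = contradiction (family i j i≢j) (~-irr eq)

    clique : Clique G image
    clique u v u∈ v∈ u≢v with ∈-image⁻ u∈ | ∈-image⁻ v∈
    ... | i , refl | j , refl = family i j (u≢v ∘ cong f)

  cons-family : ∀ {m v} {f : Fin m → Fin n} →
    (∀ i → v ~ f i) → CliqueFamily f → CliqueFamily (v ◂ f)
  cons-family v~f family zero    zero    0≢0 = contradiction refl 0≢0
  cons-family v~f family zero    (suc j) _   = v~f j
  cons-family v~f family (suc i) zero    _   = ~-sym (v~f i)
  cons-family v~f family (suc i) (suc j) i≢j = family i j (i≢j ∘ cong suc)

  vertex-family : ∀ v → CliqueFamily {1} (λ _ → v)
  vertex-family v 0F 0F 0≢0 = contradiction refl 0≢0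

  edge-family : ∀ {u v} → u ~ v → CliqueFamily (u ◂ λ (_ : Fin 1) → v)
  edge-family {v = v} u~v = cons-family (λ _ → u~v) (vertex-family v)

  colourable⇒partite : ∀ {k} → Colourable G k → Partite G k
  colourable⇒partite (c , proper) = fibres c , fibres-partition c , λ i u v u∈ v∈ u~v →
    proper u v u~v (trans (∈-fibres⁻ c i u∈) (sym (∈-fibres⁻ c i v∈)))

module _ {n} (G : Graph n) where
  open Graph G

  -- Cliques of the subgraph are cliques of `G`, which gives `≤`; the clique `x` lies in `X`, which
  -- gives `≥`.
  ω-induced : ∀ {w} → CliqueBound G w → (x : Fin w → Fin n) → CliqueFamily G x →
    (X : Subset n) → (∀ i → x i ∈ X) → ω ⟨ G ⟩[ X ] ≡ w
  ω-induced bound x family X x∈X = ℕ.≤-antisym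
    (let y , y-family = hasClique⇒family ⟨ G ⟩[ X ] (ω-attained ⟨ G ⟩[ X ]) in
      bound (element X ∘ y) y-family)
    (ω-bound ⟨ G ⟩[ X ] (proj₁ ∘ position) λ i j i≢j →
      subst₂ _~_ (sym (proj₂ (position i))) (sym (proj₂ (position j))) (family i j i≢j))
    where
    position : ∀ i → ∃ λ u → element X u ≡ x i
    position i = element-surjective X (x∈X i)

  -- This is the form in which the hypothesis on induced subgraphs is used: if
  -- x is adjacent to a, then x and the 2K₂ form a butterfly, else a hammer.
  NoApex : Set
  NoApex = ∀ {a b c d x} → a ~ b → c ~ d → ¬ a ~ c → ¬ a ~ d → ¬ b ~ c → ¬ b ~ d →
    x ~ b → x ~ c → x ~ d → Empty.⊥

  noApex : ((5 , butterfly) ∷ (5 , hammer) ∷ []) -Free G → NoApex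
  noApex (no-butterfly ∷ no-hammer ∷ []) {a} {b} {c} {d} {x} ab cd ac ad bc bd xb xc xd =
    by-cases (x ~? a)
    where
    -- Of the two vertices `w` is adjacent to `u` only, which separates them.
    apart : ∀ {u v w} → w ~ u → ¬ w ~ v → ¬ u ~ v → u ≢ v × ¬ u ~ v
    apart wu ¬wv ¬uv = (λ { refl → ¬wv wu }) , ¬uv

    flip : ∀ {u v} → u ≢ v × ¬ u ~ v → v ≢ u × ¬ v ~ u
    flip (u≢v , ¬uv) = ≢-sym u≢v , ¬uv ∘ ~-sym

    a∥c = apart (~-sym ab) bc ac
    a∥d = apart (~-sym ab) bd ad
    b∥c = apart ab ac bc
    b∥d = apart ab ad bd

    by-cases : Dec (x ~ a) → Empty.⊥
    -- The common vertex of the two triangles is `x`.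
    by-cases (yes xa) = no-butterfly (copy⇒induced butterfly G
      (agrees⇒copy butterfly G (lookup (x ∷ a ∷ b ∷ c ∷ d ∷ []))
        ( (xa ∷ xb ∷ xc ∷ xd ∷ [])
        ∷ (ab ∷ a∥c ∷ a∥d ∷ [])
        ∷ (b∥c ∷ b∥d ∷ [])
        ∷ (cd ∷ []) ∷ [] ∷ [])))
    -- The triangle is `c`, `d`, `x`; the handle runs from `x` through `b` to `a`.
    by-cases (no ¬xa) = no-hammer (copy⇒induced hammer G
      (agrees⇒copy hammer G (lookup (c ∷ d ∷ x ∷ b ∷ a ∷ []))
        ( (cd ∷ ~-sym xc ∷ flip b∥c ∷ flip a∥c ∷ [])
        ∷ (~-sym xd ∷ flip b∥d ∷ flip a∥d ∷ [])
        ∷ (xb ∷ apart (~-sym xc) (ac ∘ ~-sym) ¬xa ∷ [])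
        ∷ (~-sym ab ∷ []) ∷ [] ∷ [])))

-- Pairs i ≤ j, numbered by (suc j C 2) + i

-- Pascal's rule; `suc j` is the number of pairs with larger entry `j`.
triangular-step : ∀ j → suc j C 2 + suc j ≡ suc (suc j) C 2
triangular-step j = trans (ℕ.+-comm (suc j C 2) (suc j))
  (trans (cong (_+ suc j C 2) (sym (nC1≡n (suc j)))) (nCk+nC[k+1]≡[n+1]C[k+1] (suc j) 1))

triangular-mono : ∀ {i j} → i ≤ j → suc i C 2 ≤ suc j C 2
triangular-mono = mono′ ∘ ℕ.≤⇒≤′
  where
  mono′ : ∀ {i j} → i ℕ.≤′ j → suc i C 2 ≤ suc j C 2
  mono′ ≤′-refl               = ℕ.≤-refl
  mono′ (≤′-step {n = j} i≤j) = ℕ.≤-trans (mono′ i≤j)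
    (subst (suc j C 2 ≤_) (triangular-step j) (ℕ.m≤m+n (suc j C 2) (suc j)))

-- The pairs with larger entry `j` fill the block from `suc j C 2` up to, but excluding,
-- `suc (suc j) C 2`.
pair-index-< : ∀ {i j w} → i ≤ j → j ℕ.< w → suc j C 2 + i ℕ.< suc w C 2
pair-index-< {i} {j} {w} i≤j j<w = begin-strict
  suc j C 2 + i        <⟨ ℕ.+-monoʳ-< (suc j C 2) (s≤s i≤j) ⟩
  suc j C 2 + suc j    ≡⟨ triangular-step j ⟩
  suc (suc j) C 2      ≤⟨ triangular-mono j<w ⟩
  suc w C 2            ∎
  where open ℕ.≤-Reasoning

-- `pair-index-<`, with the larger of `j` and `j′` as `w`, keeps different blocks apart; within a
-- block, cancellation recovers `i`.
pair-index-injective : ∀ {i j i′ j′} → i ≤ j → i′ ≤ j′ →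
  suc j C 2 + i ≡ suc j′ C 2 + i′ → i ≡ i′ × j ≡ j′
pair-index-injective {i} {j} {i′} {j′} i≤j i′≤j′ eq with ℕ.<-cmp j j′
... | tri< j<j′ _ _ = contradiction eq
  (ℕ.<⇒≢ (ℕ.<-≤-trans (pair-index-< i≤j j<j′) (ℕ.m≤m+n (suc j′ C 2) i′)))
... | tri≈ _ refl _ = ℕ.+-cancelˡ-≡ (suc j C 2) i i′ eq , refl
... | tri> _ _ j′<j = contradiction (sym eq)
  (ℕ.<⇒≢ (ℕ.<-≤-trans (pair-index-< i′≤j′ j′<j) (ℕ.m≤m+n (suc j C 2) i)))

-- Small index sets

-- Applied to the only index `m` that a vertex misses, this gives an edge of the clique inside its
-- neighbourhood.
two-others : ∀ {k} (m : Fin (3 + k)) → ∃₂ λ p q → p ≢ q × p ≢ m × q ≢ m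
two-others 0F            = 1F , 2F , (λ ()) , (λ ()) , (λ ())
two-others 1F            = 0F , 2F , (λ ()) , (λ ()) , (λ ())
two-others (suc (suc _)) = 0F , 1F , (λ ()) , (λ ()) , (λ ())

Except : Fin 3 → Pred (Fin 3) 0ℓ → Set
Except m P = ∀ i → i ≢ m → P i

-- Naming the exceptional index leaves three possibilities for a negative majority; they become
-- `X₂`, `X₃` and `X₄`.
majority : ∀ {P : Pred (Fin 3) 0ℓ} → Decidable P →
  (∃ λ m → Except m P) ⊎ (∃ λ m → Except m (¬_ ∘ P))
majority {P} P? = cases (P? 0F) (P? 1F) (P? 2F)
  where
  except₀ : ∀ {Q : Pred (Fin 3) 0ℓ} → Q 1F → Q 2F → Except 0F Q
  except₀ _  _  0F 0≢0 = contradiction refl 0≢0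
  except₀ q₁ _  1F _   = q₁
  except₀ _  q₂ 2F _   = q₂

  except₁ : ∀ {Q : Pred (Fin 3) 0ℓ} → Q 0F → Q 2F → Except 1F Q
  except₁ q₀ _  0F _   = q₀
  except₁ _  _  1F 1≢1 = contradiction refl 1≢1
  except₁ _  q₂ 2F _   = q₂

  except₂ : ∀ {Q : Pred (Fin 3) 0ℓ} → Q 0F → Q 1F → Except 2F Q
  except₂ q₀ _  0F _   = q₀
  except₂ _  q₁ 1F _   = q₁
  except₂ _  _  2F 2≢2 = contradiction refl 2≢2

  cases : Dec (P 0F) → Dec (P 1F) → Dec (P 2F) →
    (∃ λ m → Except m P) ⊎ (∃ λ m → Except m (¬_ ∘ P))
  cases (yes p₀) (yes p₁) _        = inj₁ (2F , except₂ p₀ p₁)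
  cases (yes p₀) (no  _)  (yes p₂) = inj₁ (1F , except₁ p₀ p₂)
  cases (yes _)  (no ¬p₁) (no ¬p₂) = inj₂ (0F , except₀ ¬p₁ ¬p₂)
  cases (no ¬p₀) (no ¬p₁) _        = inj₂ (2F , except₂ ¬p₀ ¬p₁)
  cases (no ¬p₀) (yes _)  (no ¬p₂) = inj₂ (1F , except₁ ¬p₀ ¬p₂)
  cases (no _)   (yes p₁) (yes p₂) = inj₁ (0F , except₀ p₁ p₂)

-- Three values occurring twice each would need six places, so some value occurs at most once among
-- the four. The proof is by enumeration.
rare-value : ∀ (a b c d : Fin 3) → ∃ λ m →
  (m ≢ b × m ≢ c × m ≢ d) ⊎ (m ≢ a × m ≢ c × m ≢ d) ⊎
  (m ≢ a × m ≢ b × m ≢ d) ⊎ (m ≢ a × m ≢ b × m ≢ c)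
rare-value = from-yes (all? λ a → all? λ b → all? λ c → all? λ d → any? λ m →
  differ? m b c d ⊎-dec differ? m a c d ⊎-dec differ? m a b d ⊎-dec differ? m a b c)
  where
  differ? : (m a b c : Fin 3) → Dec (m ≢ a × m ≢ b × m ≢ c)
  differ? m a b c = ¬? (m ≟ a) ×-dec ¬? (m ≟ b) ×-dec ¬? (m ≟ c)

-- The claim for a given clique number

module _ {n} (G : Graph n) where
  open Graph G

  -- Stated for a variable `w`, so that `conclude` can match on it; `theorem3p2` takes `w` to be
  -- `ω G`.
  Conclusion : ℕ → Set₁
  Conclusion w =
    (Σ[ X₁ ∈ Subset n ] Σ[ X₂ ∈ Subset n ] Σ[ X₃ ∈ Subset n ] Σ[ X₄ ∈ Subset n ] Σ[ X₅ ∈ Subset n ]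
      ( IsPartition (X₁ ∷ X₂ ∷ X₃ ∷ X₄ ∷ X₅ ∷ [])
      × Dominating G X₁
      × Partite ⟨ G ⟩[ X₁ ] w
      × ω ⟨ G ⟩[ X₁ ] ≡ w
      × Independent G X₂
      × Independent G X₃
      × Independent G X₄
      × ((4 , 2K₂) ∷ []) -Free ⟨ G ⟩[ X₁ ∪ X₅ ]))
    × χ G ≤ (w + 1) C 2

  restrict-colouring : ∀ {k} (X : Subset n) (c : Fin n → Fin k) →
    (∀ {u v} → u ∈ X → v ∈ X → u ~ v → c u ≢ c v) → Colourable ⟨ G ⟩[ X ] k
  restrict-colouring X c proper =
    c ∘ element X , λ u v → proper (element-∈ X u) (element-∈ X v)

  2K₂-free : (X : Subset n) →
    (∀ {a b c d} → a ∈ X → b ∈ X → c ∈ X → d ∈ X → a ~ b → c ~ d →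
      ¬ a ~ c → ¬ a ~ d → ¬ b ~ c → ¬ b ~ d → Empty.⊥) →
    ((4 , 2K₂) ∷ []) -Free ⟨ G ⟩[ X ]
  2K₂-free X excluded = (λ (S , iso) →
    let at       = λ i → element S (Inverse.from (_≅_.vertices iso) i)
        at∈      = λ i → element-∈ X (at i)
        edge     = λ i j → Equivalence.from (≅⇒adjacent iso i j)
        non-edge = λ i j → Equivalence.to (≅⇒adjacent iso i j)
    in excluded (at∈ 0F) (at∈ 1F) (at∈ 2F) (at∈ 3F)
      (edge 0F 1F (from-yes (Graph._~?_ 2K₂ 0F 1F)))
      (edge 2F 3F (from-yes (Graph._~?_ 2K₂ 2F 3F)))
      (from-no (Graph._~?_ 2K₂ 0F 2F) ∘ non-edge 0F 2F)
      (from-no (Graph._~?_ 2K₂ 0F 3F) ∘ non-edge 0F 3F)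
      (from-no (Graph._~?_ 2K₂ 1F 2F) ∘ non-edge 1F 2F)
      (from-no (Graph._~?_ 2K₂ 1F 3F) ∘ non-edge 1F 3F)) ∷ []

-- Clique number at most 1

module EdgelessCase {n} (G : Graph n) (edgeless : ∀ {u v} → ¬ Graph._~_ G u v)
  {w} (w≤1 : w ≤ 1) (bound : CliqueBound G w)
  (x : Fin w → Fin n) (x-family : CliqueFamily G x)
  where

  label : Fin n → Fin 5
  label _ = 0F

  colour : Fin n → Fin w
  -- A single vertex is a clique, so `bound` gives `1 ≤ w`, read here as `0 < w`: every vertex gets
  -- colour 0. For `w = 0` there are no vertices.
  colour v = fromℕ< (bound (λ _ → v) (vertex-family G v))

  independent : ∀ {S} → Independent G S
  independent u v _ _ = edgeless

  conclusion : Conclusion G w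
  conclusion =
    ( fibre label 0F , fibre label 1F , fibre label 2F , fibre label 3F , fibre label 4F
    , fibres-partition label
    , (λ v v∉ → contradiction (∈-fibre⁺ label refl) v∉)
    , colourable⇒partite ⟨ G ⟩[ fibre label 0F ]
        (restrict-colouring G _ colour λ _ _ u~v → contradiction u~v edgeless)
    , ω-induced G bound x x-family _ (λ _ → ∈-fibre⁺ label refl)
    , independent , independent , independent
    , 2K₂-free G _ (λ _ _ _ _ a~b _ _ _ _ _ → edgeless a~b)
    )
    , ℕ.≤-trans (χ-lower G (colour , λ _ _ u~v → contradiction u~v edgeless)) (small w≤1)
    where
    small : ∀ {w} → w ≤ 1 → w ≤ (w + 1) C 2
    small z≤n       = z≤n
    small (s≤s z≤n) = s≤s z≤n

-- Clique number at least 3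

module LargeCase {n} (G : Graph n) (connected : Connected G) (no-apex : NoApex G)
  {k} (bound : CliqueBound G (3 + k))
  (x : Fin (3 + k) → Fin n) (x-family : CliqueFamily G x)
  where
  open Graph G

  w : ℕ
  w = 3 + k

  Misses : Fin n → Fin w → Set
  Misses v i = ¬ v ~ x i

  misses? : ∀ v i → Dec (Misses v i)
  misses? v i = ¬? (v ~? x i)

  -- Only uniqueness is demanded; `some-missed` provides existence.
  MissesOne : Fin n → Set
  MissesOne v = ∀ i j → Misses v i → Misses v j → i ≡ j

  missesOne? : ∀ v → Dec (MissesOne v)
  missesOne? v = all? λ i → all? λ j → misses? v i →-dec (misses? v j →-dec (i ≟ j))

  ¬misses : ∀ {v i} → ¬ Misses v i → v ~ x i
  ¬misses {v} {i} = decidable-stable (v ~? x i)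

  x-misses : ∀ {i j} → Misses (x i) j → i ≡ j
  x-misses {i} {j} miss with i ≟ j
  ... | yes i≡j = i≡j
  ... | no  i≢j = contradiction (x-family i j i≢j) miss

  x-missesOne : ∀ i → MissesOne (x i)
  x-missesOne _ _ _ p q = trans (sym (x-misses p)) (x-misses q)

  -- Adding `v` would give a clique of `suc w` vertices. The family is arbitrary because
  -- `missesOne-independent` uses one other than `x`.
  not-dominated : ∀ {f : Fin w → Fin n} → CliqueFamily G f → ∀ v → ¬ (∀ i → v ~ f i)
  not-dominated family v v~f = ℕ.1+n≰n (bound (v ◂ _) (cons-family G v~f family))

  some-missed : ∀ v → ∃ (Misses v)
  some-missed v = ¬∀⟶∃¬ w (λ i → v ~ x i) (λ i → v ~? x i) (not-dominated x-family v)

  -- Replacing xᵢ by v gives another maximum clique, and u dominates it.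
  missesOne-independent : ∀ {u v i} → MissesOne u → MissesOne v →
    Misses u i → Misses v i → ¬ u ~ v
  missesOne-independent {u} {v} {i} one-u one-v miss-u miss-v u~v =
    not-dominated family u u~f
    where
    f : Fin w → Fin n
    f j = if does (j ≟ i) then v else x j

    family : CliqueFamily G f
    family j l j≢l with j ≟ i | l ≟ i
    ... | yes refl | yes refl = contradiction refl j≢l
    ... | yes _    | no  l≢i  = ¬misses (λ miss → l≢i (one-v l i miss miss-v))
    ... | no  j≢i  | yes _    = ~-sym (¬misses (λ miss → j≢i (one-v j i miss miss-v)))
    ... | no  _    | no  _    = x-family j l j≢l

    u~f : ∀ j → u ~ f j
    u~f j with j ≟ i
    ... | yes _  = u~v
    ... | no j≢i = ¬misses (λ miss → j≢i (one-u j i miss miss-u))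

  -- The edges from `v` to `u` and from `x i` to `x j` form an induced 2K₂, and `x l` would be
  -- adjacent to `u`, `x i` and `x j`.
  missesPair-neighbour : ∀ {u v i j l} → i ≢ j → Misses u i → Misses v i → Misses u j → Misses v j →
    u ~ v → ¬ u ~ x l
  missesPair-neighbour {u} {v} {i} {j} {l} i≢j ui vi uj vj u~v u~xl =
    no-apex (~-sym u~v) (x-family i j i≢j) vi vj ui uj (~-sym u~xl)
      (x-family l i λ { refl → ui u~xl }) (x-family l j λ { refl → uj u~xl })

  -- Vertices without neighbours in the clique

  Far : Fin n → Set
  Far v = ∀ i → Misses v i

  -- If `u` missed two indices, `v` would miss them too, and `missesPair-neighbour` would forbid
  -- `u ~ x i`.
  far-neighbour : ∀ {v u i} → Far v → v ~ u → u ~ x i → MissesOne u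
  far-neighbour {v} far v~u u~xi p q miss-p miss-q with p ≟ q
  ... | yes p≡q = p≡q
  ... | no  p≢q = contradiction u~xi
    (missesPair-neighbour p≢q miss-p (far p) miss-q (far q) (~-sym v~u))

  x₀-near : ¬ Far (x 0F)
  x₀-near far = far 1F (x-family 0F 1F λ ())

  -- Connectedness enters here: an edge between far vertices is pushed along a path to the clique
  -- until the path leaves the far vertices.
  far-independent : ∀ {v v′} → Far v → Far v′ → ¬ v ~ v′
  far-independent {v} far far′ v~v′ = along (connected v (x 0F)) far far′ v~v′
    where
    along : ∀ {v v′} → Star _~_ v (x 0F) → Far v → Far v′ → ¬ v ~ v′
    along ε far _ _ = x₀-near far
    along {v} {v′} (_◅_ {j = u} v~u path) far far′ v~v′ with any? (λ i → u ~? x i)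
    -- The next vertex is far as well, so the edge from `u` to `v` takes over.
    ... | no  u-far = along path (λ i u~xi → u-far (i , u~xi)) far (~-sym v~u)
    ... | yes (i , u~xi) =
      let one            = far-neighbour far v~u u~xi
          m , miss       = some-missed u
          p , q , p≢q , p≢m , q≢m = two-others m
      -- The near vertex `u` misses only `m`, so it is adjacent to `v`, `x p` and `x q`, three
      -- vertices of an induced 2K₂.
      in no-apex (~-sym v~v′) (x-family p q p≢q) (far′ p) (far′ q) (far p) (far q) (~-sym v~u)
           (¬misses λ miss-p → p≢m (one p m miss-p miss)) (¬misses λ miss-q → q≢m (one q m miss-q miss))

  -- By `missesPair-neighbour`, used in both directions, an edge would join two far vertices.
  missesPair-independent : ∀ {u v i j} → i ≢ j →
    Misses u i → Misses v i → Misses u j → Misses v j → ¬ u ~ v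
  missesPair-independent i≢j ui vi uj vj u~v = far-independent
    (λ _ → missesPair-neighbour i≢j ui vi uj vj u~v)
    (λ _ → missesPair-neighbour i≢j vi ui vj uj (~-sym u~v))
    u~v

  -- Colouring by missed pairs

  record MissedPair (v : Fin n) : Set where
    field
      i j     : Fin w
      ordered : toℕ i ≤ toℕ j
      miss-i  : Misses v i
      miss-j  : Misses v j
      single  : i ≡ j → MissesOne v

  -- A pair with `i < j` is sought first; an index is doubled only if there is none, which is what
  -- `single` records.
  missedPair : ∀ v → MissedPair v
  missedPair v with any? (λ i → any? λ j → (i <? j) ×-dec misses? v i ×-dec misses? v j)
  ... | yes (i , j , i<j , miss-i , miss-j) = record
    { ordered = ℕ.<⇒≤ i<j ; miss-i = miss-i ; miss-j = miss-j
    ; single  = λ i≡j → contradiction (cong toℕ i≡j) (ℕ.<⇒≢ i<j) }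
  ... | no none = let i , miss = some-missed v in record
    { ordered = ℕ.≤-refl ; miss-i = miss ; miss-j = miss ; single = λ _ → one }
    where
    one : MissesOne v
    one p q miss-p miss-q with <-cmp p q
    ... | tri< p<q _ _ = contradiction (p , q , p<q , miss-p , miss-q) none
    ... | tri≈ _ p≡q _ = p≡q
    ... | tri> _ _ q<p = contradiction (q , p , q<p , miss-q , miss-p) none

  module P (v : Fin n) = MissedPair (missedPair v)

  pair-colour : ∀ v → Fin (suc w C 2)
  pair-colour v = fromℕ< (pair-index-< (P.ordered v) (toℕ<n (P.j v)))

  -- A doubled index falls under `missesOne-independent`, a proper pair under
  -- `missesPair-independent`.
  same-pair : ∀ {u v} → P.i u ≡ P.i v → P.j u ≡ P.j v → ¬ u ~ v
  same-pair {u} {v} i≡ j≡ with P.i u ≟ P.j u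
  ... | yes i≡j = missesOne-independent
    (P.single u i≡j) (P.single v (trans (sym i≡) (trans i≡j j≡)))
    (P.miss-i u) (subst (Misses v) (sym i≡) (P.miss-i v))
  ... | no  i≢j = missesPair-independent i≢j
    (P.miss-i u) (subst (Misses v) (sym i≡) (P.miss-i v))
    (P.miss-j u) (subst (Misses v) (sym j≡) (P.miss-j v))

  pair-colour-proper : ∀ u v → u ~ v → pair-colour u ≢ pair-colour v
  pair-colour-proper u v u~v eq =
    let i≡ , j≡ = pair-index-injective (P.ordered u) (P.ordered v)
                    (fromℕ<-injective _ _
                      (pair-index-< (P.ordered u) (toℕ<n (P.j u)))
                      (pair-index-< (P.ordered v) (toℕ<n (P.j v))) eq)
    in same-pair (toℕ-injective i≡) (toℕ-injective j≡) u~v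

  -- The partition into five classes

  AdjacentToTwo MissesTwo : Fin n → Fin 3 → Set
  AdjacentToTwo v t = Except t (λ i → v ~ x (i ↑ˡ k))
  MissesTwo     v t = Except t (λ i → Misses v (i ↑ˡ k))

  -- Kinds overlap: `MissesOne` implies kind `4F`. Testing `MissesOne` first in `classify` puts all
  -- such vertices, the clique among them, into `X₁`.
  Kind : Fin n → Fin 5 → Set
  Kind v 0F = MissesOne v
  Kind v 1F = MissesTwo v 0F
  Kind v 2F = MissesTwo v 1F
  Kind v 3F = MissesTwo v 2F
  Kind v 4F = ∃ (AdjacentToTwo v)

  classify : ∀ v → ∃ (Kind v)
  classify v with missesOne? v | majority (λ i → v ~? x (i ↑ˡ k))
  ... | yes one | _                = 0F , one
  ... | no  _   | inj₁ adj         = 4F , adj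
  ... | no  _   | inj₂ (0F , miss) = 1F , miss
  ... | no  _   | inj₂ (1F , miss) = 2F , miss
  ... | no  _   | inj₂ (2F , miss) = 3F , miss

  label : Fin n → Fin 5
  label v = proj₁ (classify v)

  ∈-label⁻ : ∀ i {v} → v ∈ fibre label i → Kind v i
  ∈-label⁻ i {v} v∈ = subst (Kind v) (∈-fibre⁻ label v∈) (proj₂ (classify v))

  missesOne⇒∈ : ∀ {v} → MissesOne v → v ∈ fibre label 0F
  missesOne⇒∈ {v} one = ∈-fibre⁺ label label≡0
    where
    label≡0 : label v ≡ 0F
    -- Abstracting the same two expressions as `classify` lets `label v` reduce.
    label≡0 with missesOne? v | majority (λ i → v ~? x (i ↑ˡ k))
    ... | yes _   | _ = refl
    ... | no ¬one | _ = contradiction one ¬one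

  -- A near vertex has a neighbour in the clique, which lies in `X₁`. The next vertex on a path from
  -- a far vertex to the clique is near by `far-independent`, hence in `X₁` by `far-neighbour`.
  dominating : Dominating G (fibre label 0F)
  dominating v v∉ with any? (λ i → v ~? x i)
  ... | yes (i , v~xi) = x i , missesOne⇒∈ (x-missesOne i) , v~xi
  ... | no  none       = step (connected v (x 0F))
    where
    far : Far v
    far i v~xi = none (i , v~xi)

    step : Star _~_ v (x 0F) → ∃ λ u → u ∈ fibre label 0F × v ~ u
    step ε = contradiction far x₀-near
    step (_◅_ {j = u} v~u _) with any? (λ i → u ~? x i)
    ... | yes (i , u~xi) = u , missesOne⇒∈ (far-neighbour far v~u u~xi) , v~u
    ... | no  u-far      = contradiction v~u (far-independent far λ i u~xi → u-far (i , u~xi))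

  two-others′ : (t : Fin 3) → ∃₂ λ p q → p ↑ˡ k ≢ q ↑ˡ k × p ≢ t × q ≢ t
  two-others′ t = let p , q , p≢q , p≢t , q≢t = two-others t in
    p , q , p≢q ∘ ↑ˡ-injective k p q , p≢t , q≢t

  missesTwo-independent : ∀ t {u v} → MissesTwo u t → MissesTwo v t → ¬ u ~ v
  missesTwo-independent t miss-u miss-v = let p , q , p≢q , p≢t , q≢t = two-others′ t in
    missesPair-independent p≢q (miss-u p p≢t) (miss-v p p≢t) (miss-u q q≢t) (miss-v q q≢t)

  missesOne⇒adjacentToTwo : ∀ {v} → MissesOne v → ∃ (AdjacentToTwo v)
  missesOne⇒adjacentToTwo {v} one with majority (λ i → v ~? x (i ↑ˡ k))
  ... | inj₁ adj        = adj
  ... | inj₂ (t , miss) = let p , q , p≢q , p≢t , q≢t = two-others′ t in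
    contradiction (one _ _ (miss p p≢t) (miss q q≢t)) p≢q

  X₁∪X₅⇒adjacentToTwo : ∀ {v} → v ∈ fibre label 0F ∪ fibre label 4F → ∃ (AdjacentToTwo v)
  X₁∪X₅⇒adjacentToTwo v∈ with x∈p∪q⁻ (fibre label 0F) (fibre label 4F) v∈
  ... | inj₁ v∈X₁ = missesOne⇒adjacentToTwo (∈-label⁻ 0F v∈X₁)
  ... | inj₂ v∈X₅ = ∈-label⁻ 4F v∈X₅

  -- An index `m` that is exceptional for at most one of the four vertices makes `x m` adjacent to
  -- the other three.
  adjacentToTwo-2K₂ : ∀ {a b c d} → ∃ (AdjacentToTwo a) → ∃ (AdjacentToTwo b) →
    ∃ (AdjacentToTwo c) → ∃ (AdjacentToTwo d) → a ~ b → c ~ d →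
    ¬ a ~ c → ¬ a ~ d → ¬ b ~ c → ¬ b ~ d → Empty.⊥
  adjacentToTwo-2K₂ {a} {b} {c} {d} (s , a~) (t , b~) (r , c~) (q , d~) ab cd ac ad bc bd
    with rare-value s t r q
  -- In each case the 2K₂ is turned so that the vertex left out comes first, in the place of `a` in
  -- `NoApex`.
  ... | m , inj₁ (m≢t , m≢r , m≢q) =
    no-apex ab cd ac ad bc bd (~-sym (b~ m m≢t)) (~-sym (c~ m m≢r)) (~-sym (d~ m m≢q))
  ... | m , inj₂ (inj₁ (m≢s , m≢r , m≢q)) =
    no-apex (~-sym ab) cd bc bd ac ad (~-sym (a~ m m≢s)) (~-sym (c~ m m≢r)) (~-sym (d~ m m≢q))
  ... | m , inj₂ (inj₂ (inj₁ (m≢s , m≢t , m≢q))) =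
    no-apex cd ab (ac ∘ ~-sym) (bc ∘ ~-sym) (ad ∘ ~-sym) (bd ∘ ~-sym)
      (~-sym (d~ m m≢q)) (~-sym (a~ m m≢s)) (~-sym (b~ m m≢t))
  ... | m , inj₂ (inj₂ (inj₂ (m≢s , m≢t , m≢r))) =
    no-apex (~-sym cd) ab (ad ∘ ~-sym) (bd ∘ ~-sym) (ac ∘ ~-sym) (bc ∘ ~-sym)
      (~-sym (c~ m m≢r)) (~-sym (a~ m m≢s)) (~-sym (b~ m m≢t))

  -- The colour is the missed index, and `missesOne-independent` makes it proper.
  X₁-colouring : Colourable ⟨ G ⟩[ fibre label 0F ] w
  X₁-colouring = restrict-colouring G _ (proj₁ ∘ some-missed) λ {u} {v} u∈ v∈ u~v eq →
    missesOne-independent (∈-label⁻ 0F u∈) (∈-label⁻ 0F v∈)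
      (proj₂ (some-missed u)) (subst (Misses v) (sym eq) (proj₂ (some-missed v))) u~v

  conclusion : Conclusion G w
  conclusion =
    ( fibre label 0F , fibre label 1F , fibre label 2F , fibre label 3F , fibre label 4F
    , fibres-partition label
    , dominating
    , colourable⇒partite ⟨ G ⟩[ fibre label 0F ] X₁-colouring
    , ω-induced G bound x x-family _ (λ i → missesOne⇒∈ (x-missesOne i))
    , (λ u v u∈ v∈ → missesTwo-independent 0F (∈-label⁻ 1F u∈) (∈-label⁻ 1F v∈))
    , (λ u v u∈ v∈ → missesTwo-independent 1F (∈-label⁻ 2F u∈) (∈-label⁻ 2F v∈))
    , (λ u v u∈ v∈ → missesTwo-independent 2F (∈-label⁻ 3F u∈) (∈-label⁻ 3F v∈))
    , 2K₂-free G _ (λ a∈ b∈ c∈ d∈ → adjacentToTwo-2K₂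
        (X₁∪X₅⇒adjacentToTwo a∈) (X₁∪X₅⇒adjacentToTwo b∈)
        (X₁∪X₅⇒adjacentToTwo c∈) (X₁∪X₅⇒adjacentToTwo d∈))
    )
    , subst (λ m → χ G ≤ m C 2) (ℕ.+-comm 1 w) (χ-lower G (pair-colour , pair-colour-proper))

-- Case distinction on the clique number

conclude : ∀ {n} (G : Graph n) → Connected G → NoApex G →
  ∀ w → CliqueBound G w → (x : Fin w → Fin n) → CliqueFamily G x → w ≢ 2 → Conclusion G w
conclude G connected no-apex (suc (suc (suc _))) bound x family _ =
  LargeCase.conclusion G connected no-apex bound x family
conclude G _ _ 2 _ _ _ 2≢2 = contradiction refl 2≢2
-- An edge would be a clique of two vertices, against `bound`; likewise for `w = 0`.
conclude G _ _ 1 bound x family _ = EdgelessCase.conclusion G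
  (λ u~v → ℕ.1+n≰n (bound _ (edge-family G u~v))) (s≤s z≤n) bound x family
conclude G _ _ 0 bound x family _ = EdgelessCase.conclusion G
  (λ u~v → contradiction (bound _ (edge-family G u~v)) λ ()) z≤n bound x family

theorem3p2 : ∀ {n : ℕ} (G : Graph n) →
    Connected G →
    ((5 , butterfly) ∷ (5 , hammer) ∷ []) -Free G →
    ω G ≢ 2 →
    (Σ[ X₁ ∈ Subset n ] Σ[ X₂ ∈ Subset n ] Σ[ X₃ ∈ Subset n ] Σ[ X₄ ∈ Subset n ] Σ[ X₅ ∈ Subset n ]
    ( IsPartition (X₁ ∷ X₂ ∷ X₃ ∷ X₄ ∷ X₅ ∷ [])
    × Dominating G X₁
    × Partite ⟨ G ⟩[ X₁ ] (ω G)
    × ω ⟨ G ⟩[ X₁ ] ≡ ω G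
    × Independent G X₂
    × Independent G X₃
    × Independent G X₄
    × ((4 , 2K₂) ∷ []) -Free ⟨ G ⟩[ X₁ ∪ X₅ ]))
    × χ G ≤ (ω G + 1) C 2
theorem3p2 G connected free ω≢2 =
  let x , family = hasClique⇒family G (ω-attained G) in
  conclude G connected (noApex G free) (ω G) (ω-bound G) x family ω≢2
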